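{- Let $n\ge 2$ be an integer. The path $P_n$ of order $n$ is an SR-graph if and only if $n=3$, or $n\geq 4$ and $n\equiv 1 \pmod 3$.
   Context: $\gamma(G)$ denotes the domination number of a finite simple graph $G$ (minimum cardinality of a set $X\subseteq V(G)$ such that every vertex is in $X$ or adjacent to a vertex of $X$). For an edge $e=uv$ of $G$, $G-e$ is the graph obtained by deleting $e$, and $G_e$ is the graph obtained by subdividing $e$: delete $e$, add a new vertex $w$ and the edges $uw$ and $wv$. A finite connected simple graph $G$ of order at least two is an SR-graph (sub-removable graph) if $\gamma(G-e)=\gamma(G_e)$ for every edge $e$ of $G$. -}

module Defs where

open import Data.Empty using (⊥)
open import Data.Fin using (Fin; zero; suc; toℕ)
open import Data.Fin.Properties using (all?; any?) renaming (_≟_ to _≟ᶠ_)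
open import Data.Fin.Subset using (Subset; _∈_; ∣_∣; ⊤)
open import Data.Fin.Subset.Properties using (_∈?_; anySubset?; ∈⊤)
open import Data.Nat using (ℕ; suc; _≤_; _<_)
open import Data.Nat.Induction using (<-wellFounded)
open import Data.Nat.Properties using (_≟_; _<?_; ≮⇒≥; 1+n≢n)
open import Data.Product using (Σ-syntax; ∃; ∃-syntax; _×_; _,_; proj₁; proj₂; swap)
open import Data.Sum as Sum using (_⊎_; inj₁; inj₂)
open import Function using (_∘_)
open import Induction.WellFounded using (Acc; acc)
open import Level using (0ℓ)
open import Relation.Binary.Construct.Closure.ReflexiveTransitive using (Star)
open import Relation.Binary.Core using (Rel)
open import Relation.Binary.Definitions using (Symmetric; Irreflexive; Decidable)
open import Relation.Binary.PropositionalEquality using (_≡_; refl)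
open import Relation.Nullary using (Dec; yes; no; ¬_; ¬?; _×-dec_; _⊎-dec_)

-- Finite simple graphs of order n.  Decidability of adjacency is automatic
-- classically; here it is what makes the domination number computable.
record Graph (n : ℕ) : Set₁ where
  field
    Adj        : Rel (Fin n) 0ℓ
    adj-sym    : Symmetric Adj
    adj-irrefl : Irreflexive _≡_ Adj
    adj?       : Decidable Adj

open Graph public

private
  variable
    n : ℕ

Connected : Graph n → Set
Connected G = ∀ u v → Star (Adj G) u v

-- An edge together with an ordering of its two ends, so that each edge uv
-- occurs both as (u , v) and as (v , u).
Edge : Graph n → Set
Edge {n} G = Σ[ u ∈ Fin n ] Σ[ v ∈ Fin n ] Adj G u v

Dominating : Graph n → Subset n → Set
Dominating G X = ∀ v → v ∈ X ⊎ (∃[ x ] x ∈ X × Adj G v x)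

dominating? : (G : Graph n) (X : Subset n) → Dec (Dominating G X)
dominating? G X =
  all? λ v → (v ∈? X) ⊎-dec any? λ x → (x ∈? X) ×-dec adj? G v x

record IsDominationNumber (G : Graph n) (k : ℕ) : Set where
  field
    attained : ∃[ X ] Dominating G X × ∣ X ∣ ≡ k
    minimal  : ∀ X → Dominating G X → k ≤ ∣ X ∣

dominationNumber : (G : Graph n) → ∃ (IsDominationNumber G)
dominationNumber G = descend ⊤ (λ _ → inj₁ ∈⊤) (<-wellFounded _)
  where
  descend : ∀ X → Dominating G X → Acc _<_ ∣ X ∣ → ∃ (IsDominationNumber G)
  descend X dom (acc rec)
    with anySubset? (λ Y → dominating? G Y ×-dec (∣ Y ∣ <? ∣ X ∣))
  ... | yes (Y , domY , Y<X) = descend Y domY (rec Y<X)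
  ... | no none = ∣ X ∣ , record
    { attained = X , dom , refl
    ; minimal  = λ Y domY → ≮⇒≥ λ Y<X → none (Y , domY , Y<X)
    }

γ : Graph n → ℕ
γ G = proj₁ (dominationNumber G)

γ-isDominationNumber : (G : Graph n) → IsDominationNumber G (γ G)
γ-isDominationNumber G = proj₂ (dominationNumber G)

SamePair : (u v x y : Fin n) → Set
SamePair u v x y = (x ≡ u × y ≡ v) ⊎ (x ≡ v × y ≡ u)

samePair? : (u v x y : Fin n) → Dec (SamePair u v x y)
samePair? u v x y =
  ((x ≟ᶠ u) ×-dec (y ≟ᶠ v)) ⊎-dec ((x ≟ᶠ v) ×-dec (y ≟ᶠ u))

samePair-swap : {u v x y : Fin n} → SamePair u v x y → SamePair u v y x
samePair-swap = Sum.swap ∘ Sum.map swap swap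

deleteEdge : (G : Graph n) → Edge G → Graph n
deleteEdge G (u , v , _) = record
  { Adj        = λ x y → Adj G x y × ¬ SamePair u v x y
  ; adj-sym    = λ (xy , x≁y) → adj-sym G xy , x≁y ∘ samePair-swap
  ; adj-irrefl = λ x≡y (xy , _) → adj-irrefl G x≡y xy
  ; adj?       = λ x y → adj? G x y ×-dec ¬? (samePair? u v x y)
  }

-- The new vertex is zero; each old vertex x becomes suc x.
subdivideEdge : (G : Graph n) → Edge G → Graph (suc n)
subdivideEdge {n} G e@(u , v , _) = record
  { Adj        = A
  ; adj-sym    = λ {x} {y} → A-sym x y
  ; adj-irrefl = λ {x} {y} → A-irrefl x y
  ; adj?       = A?
  }
  where
  A : Rel (Fin (suc n)) 0ℓ
  A zero    zero    = ⊥
  A zero    (suc y) = y ≡ u ⊎ y ≡ v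
  A (suc x) zero    = x ≡ u ⊎ x ≡ v
  A (suc x) (suc y) = Adj (deleteEdge G e) x y

  A-sym : ∀ x y → A x y → A y x
  A-sym zero    (suc y) p = p
  A-sym (suc x) zero    p = p
  A-sym (suc x) (suc y) p = adj-sym (deleteEdge G e) p

  A-irrefl : ∀ x y → x ≡ y → ¬ A x y
  A-irrefl (suc x) .(suc x) refl = adj-irrefl (deleteEdge G e) refl

  A? : Decidable A
  A? zero    zero    = no λ ()
  A? zero    (suc y) = (y ≟ᶠ u) ⊎-dec (y ≟ᶠ v)
  A? (suc x) zero    = (x ≟ᶠ u) ⊎-dec (x ≟ᶠ v)
  A? (suc x) (suc y) = adj? (deleteEdge G e) x y

record IsSRGraph {n : ℕ} (G : Graph n) : Set where
  field
    order≥2   : 2 ≤ n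
    connected : Connected G
    removable : ∀ e → γ (deleteEdge G e) ≡ γ (subdivideEdge G e)

path : ∀ n → Graph n
path n = record
  { Adj        = λ i j → suc (toℕ i) ≡ toℕ j ⊎ suc (toℕ j) ≡ toℕ i
  ; adj-sym    = Sum.swap
  ; adj-irrefl = λ { refl (inj₁ p) → 1+n≢n p ; refl (inj₂ p) → 1+n≢n p }
  ; adj?       = λ i j →
      (suc (toℕ i) ≟ toℕ j) ⊎-dec (suc (toℕ j) ≟ toℕ i)
  }

{-# OPTIONS --safe #-}

-- Call a graph tiled by K when K indexes both a family of closed neighbourhoods
-- covering all vertices and a family of pairwise disjoint closed neighbourhoods;
-- its domination number is then the size of K.  The path P_m has such a tiling
-- of size ⌈ m /3⌉, and tilings pass to disjoint unions and along isomorphisms.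
-- Deleting the edge of P_(a+b) that joins its first a vertices to the last b
-- leaves P_a ⊎ P_b, while subdividing it gives P_(1+a+b), so P_n is an SR-graph
-- iff ⌈ a /3⌉ + ⌈ b /3⌉ ≡ ⌈ 1 + n /3⌉ whenever n = a + b with a , b ≥ 1.
module Submission where

open import Defs
open import Data.Empty using (⊥-elim)
open import Data.Fin
  using (Fin; zero; suc; toℕ; fromℕ; inject₁; punchIn; join; _↑ˡ_; _↑ʳ_)
open import Data.Fin.Permutation using (insert) renaming (id to idₚ)
open import Data.Fin.Properties
  using (toℕ-injective; toℕ<n; toℕ-fromℕ; toℕ-inject₁; toℕ-↑ˡ; toℕ-↑ʳ; +↔⊎)
open import Data.Fin.Subset using (Subset; inside; outside; _∈_; _∪_; ⁅_⁆; ⊤; ⊥; ∣_∣)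
open import Data.Fin.Subset.Properties
  using (∈⊤; ∣⊤∣≡n; ∣⊥∣≡0; ∣⁅x⁆∣≡1; x∈⁅x⁆; x∈p∪q⁺; p⊆q⇒∣p∣≤∣q∣)
open import Data.Nat using (ℕ; zero; suc; _+_; _≤_; _<_; z≤n; s≤s)
open import Data.Nat.DivMod using (_%_)
open import Data.Nat.Properties
  using ( ≤-reflexive; ≤-trans; ≤-antisym; <-irrefl; <⇒≤; <-≤-trans; ≤-<-trans
        ; ≮⇒≥; _<?_; n≤1+n; m≤n⇒m≤1+n; m≤m+n; +-suc; +-identityʳ; +-cancelˡ-≡
        ; +-monoʳ-≤; suc-injective; m≤n⇒∃[o]m+o≡n; 1+n≢n; module ≤-Reasoning)
open import Data.Product using (_×_; _,_; proj₁)
open import Data.Sum as Sum using (_⊎_; inj₁; inj₂)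
open import Data.Sum.Relation.Binary.Pointwise using (Pointwise; inj₁; inj₂)
open import Data.Vec using ([]; _∷_; here; there)
open import Function using (_∘_; id)
open import Function.Bundles using (_⇔_; _↔_; mk⇔; Equivalence; Inverse)
open import Function.Properties.Inverse using (↔-refl; ↔-sym)
open import Level using (0ℓ)
open import Relation.Binary.Construct.Closure.Reflexive as Refl
  using (ReflClosure; refl; [_])
open import Relation.Binary.Construct.Closure.ReflexiveTransitive as Star
  using (Star; ε; _◅_; _◅◅_)
open import Relation.Binary.Core using (Rel)
open import Relation.Binary.PropositionalEquality
  using (_≡_; refl; sym; trans; cong; subst; subst₂; module ≡-Reasoning)
open import Relation.Nullary using (yes; no; ¬_; contradiction)

private
  variable
    k n : ℕ
    V W K L : Set

-- Sizes of unions and images of subsets.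

∣p∪q∣≤∣p∣+∣q∣ : (p q : Subset n) → ∣ p ∪ q ∣ ≤ ∣ p ∣ + ∣ q ∣
∣p∪q∣≤∣p∣+∣q∣ []            []            = z≤n
∣p∪q∣≤∣p∣+∣q∣ (outside ∷ p) (outside ∷ q) = ∣p∪q∣≤∣p∣+∣q∣ p q
∣p∪q∣≤∣p∣+∣q∣ (outside ∷ p) (inside  ∷ q) =
  ≤-trans (s≤s (∣p∪q∣≤∣p∣+∣q∣ p q)) (≤-reflexive (sym (+-suc ∣ p ∣ ∣ q ∣)))
∣p∪q∣≤∣p∣+∣q∣ (inside  ∷ p) (outside ∷ q) = s≤s (∣p∪q∣≤∣p∣+∣q∣ p q)
∣p∪q∣≤∣p∣+∣q∣ (inside  ∷ p) (inside  ∷ q) =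
  s≤s (≤-trans (∣p∪q∣≤∣p∣+∣q∣ p q) (+-monoʳ-≤ ∣ p ∣ (n≤1+n ∣ q ∣)))

image : (Fin n → Fin k) → Subset n → Subset k
image f []            = ⊥
image f (outside ∷ p) = image (f ∘ suc) p
image f (inside  ∷ p) = ⁅ f zero ⁆ ∪ image (f ∘ suc) p

∈-image : (f : Fin n → Fin k) {p : Subset n} {x : Fin n} → x ∈ p → f x ∈ image f p
∈-image f {inside  ∷ p} here        = x∈p∪q⁺ (inj₁ (x∈⁅x⁆ (f zero)))
∈-image f {inside  ∷ p} (there x∈p) = x∈p∪q⁺ (inj₂ (∈-image (f ∘ suc) x∈p))
∈-image f {outside ∷ p} (there x∈p) = ∈-image (f ∘ suc) x∈p

∣image∣≤ : (f : Fin n → Fin k) (p : Subset n) → ∣ image f p ∣ ≤ ∣ p ∣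
∣image∣≤ {k = k} f []    = ≤-reflexive (∣⊥∣≡0 k)
∣image∣≤ f (outside ∷ p) = ∣image∣≤ (f ∘ suc) p
∣image∣≤ f (inside  ∷ p) = begin
  ∣ ⁅ f zero ⁆ ∪ q ∣     ≤⟨ ∣p∪q∣≤∣p∣+∣q∣ ⁅ f zero ⁆ q ⟩
  ∣ ⁅ f zero ⁆ ∣ + ∣ q ∣ ≡⟨ cong (_+ ∣ q ∣) (∣⁅x⁆∣≡1 (f zero)) ⟩
  suc ∣ q ∣              ≤⟨ s≤s (∣image∣≤ (f ∘ suc) p) ⟩
  suc ∣ p ∣              ∎
  where
  open ≤-Reasoning
  q = image (f ∘ suc) p

-- Tilings and the domination number.

-- The closed neighbourhoods of the centres cover V.  Those of the peaks are
-- pairwise disjoint, as the colour of a vertex determines which one contains it;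
-- the colour of a vertex outside all of them is arbitrary.
record Tiling {V : Set} (R : Rel V 0ℓ) (K : Set) : Set where
  field
    centre    : K → V
    tile      : V → K
    covered   : ∀ v → ReflClosure R v (centre (tile v))
    peak      : K → V
    colour    : V → K
    separated : ∀ i {v} → ReflClosure R (peak i) v → colour v ≡ i

open Tiling

-- The centres form a dominating set of size at most `k`. Conversely, a dominating set meets the
-- closed neighbourhood of every peak, so `colour` maps it onto `Fin k`.
γ-tiling : {G : Graph n} → Tiling (Adj G) (Fin k) → γ G ≡ k
γ-tiling {n} {k} {G} T = ≤-antisym upper lower
  where
  open IsDominationNumber (γ-isDominationNumber G)

  C : Subset n
  C = image (centre T) ⊤

  C-dominating : Dominating G C
  C-dominating v with centre T (tile T v) | ∈-image (centre T) {⊤} {tile T v} ∈⊤ | covered T v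
  ... | _ | c∈C | refl    = inj₁ c∈C
  ... | c | c∈C | [ v~c ] = inj₂ (c , c∈C , v~c)

  upper : γ G ≤ k
  upper = ≤-trans (minimal C C-dominating)
                  (≤-trans (∣image∣≤ (centre T) ⊤) (≤-reflexive (∣⊤∣≡n k)))

  dominating⇒≤ : ∀ X → Dominating G X → k ≤ ∣ X ∣
  dominating⇒≤ X dom = begin
    k                      ≡⟨ ∣⊤∣≡n k ⟨
    ∣ ⊤ {k} ∣              ≤⟨ p⊆q⇒∣p∣≤∣q∣ {p = ⊤} (λ {i} _ → every-colour i) ⟩
    ∣ image (colour T) X ∣ ≤⟨ ∣image∣≤ (colour T) X ⟩
    ∣ X ∣                  ∎
    where
    open ≤-Reasoning
    every-colour : ∀ i → i ∈ image (colour T) X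
    every-colour i with dom (peak T i)
    ... | inj₁ p∈X =
      subst (_∈ _) (separated T i refl) (∈-image (colour T) p∈X)
    ... | inj₂ (x , x∈X , p~x) =
      subst (_∈ _) (separated T i [ p~x ]) (∈-image (colour T) x∈X)

  lower : k ≤ γ G
  lower with attained
  ... | X , dom , ∣X∣≡γ = ≤-trans (dominating⇒≤ X dom) (≤-reflexive ∣X∣≡γ)

-- Isomorphisms, change of index set and disjoint unions.

module _ {R : Rel V 0ℓ} {S : Rel W 0ℓ} (φ : V ↔ W)
         (iso : ∀ x y → R x y ⇔ S (Inverse.to φ x) (Inverse.to φ y)) where
  open Inverse φ using (to; from; strictlyInverseˡ; strictlyInverseʳ)

  inverse-iso : ∀ x y → S x y ⇔ R (from x) (from y)
  inverse-iso x y = mk⇔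
    (Equivalence.from (iso (from x) (from y)) ∘
     subst₂ S (sym (strictlyInverseˡ x)) (sym (strictlyInverseˡ y)))
    (subst₂ S (strictlyInverseˡ x) (strictlyInverseˡ y) ∘
     Equivalence.to (iso (from x) (from y)))

  -- Both directions of `iso` are used: covering is pushed forward along `to`, whereas separation is
  -- checked by pulling a neighbour of a peak back along `from`.
  transport : Tiling R K → Tiling S K
  transport T = record
    { centre    = to ∘ centre T
    ; tile      = tile T ∘ from
    ; covered   = λ w →
        subst (λ w′ → ReflClosure S w′ (to (centre T (tile T (from w))))) (strictlyInverseˡ w) 
          (Refl.map (Equivalence.to (iso _ _)) (covered T (from w)))
    ; peak      = to ∘ peak T
    ; colour    = colour T ∘ from
    ; separated = λ i p~w → separated T i
        (subst (λ v → ReflClosure R v _) (strictlyInverseʳ (peak T i))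
          (Refl.map (Equivalence.to (inverse-iso _ _)) p~w))
    }

-- Brings the index set `K ⊎ L` of a disjoint union into the form `Fin k` that `γ-tiling` expects.
reindex : {R : Rel V 0ℓ} → K ↔ L → Tiling R K → Tiling R L
reindex {R = R} φ T = record
  { centre    = centre T ∘ from
  ; tile      = to ∘ tile T
  ; covered   = λ v →
      subst (λ i → ReflClosure R v (centre T i)) (sym (strictlyInverseʳ (tile T v))) (covered T v)
  ; peak      = peak T ∘ from
  ; colour    = to ∘ colour T
  ; separated = λ i p~v → trans (cong to (separated T (from i) p~v)) (strictlyInverseˡ i)
  }
  where open Inverse φ using (to; from; strictlyInverseˡ; strictlyInverseʳ)

disjointUnion : {R : Rel V 0ℓ} {S : Rel W 0ℓ} →
                Tiling R K → Tiling S L → Tiling (Pointwise R S) (K ⊎ L)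
disjointUnion {R = R} {S = S} T U = record
  { centre    = Sum.map (centre T) (centre U)
  ; tile      = Sum.map (tile T) (tile U)
  ; covered   = λ { (inj₁ v) → Refl.map inj₁ (covered T v)
                  ; (inj₂ w) → Refl.map inj₂ (covered U w) }
  ; peak      = Sum.map (peak T) (peak U)
  ; colour    = Sum.map (colour T) (colour U)
  ; separated = λ { (inj₁ i) refl         → cong inj₁ (separated T i refl)
                  ; (inj₁ i) [ inj₁ p~v ] → cong inj₁ (separated T i [ p~v ])
                  ; (inj₂ i) refl         → cong inj₂ (separated U i refl)
                  ; (inj₂ i) [ inj₂ p~w ] → cong inj₂ (separated U i [ p~w ]) }
  }

-- Opposite orientations of an edge give isomorphic but not equal graphs.

deleteEdge-flip : (G : Graph n) {u v : Fin n} (p : Adj G u v) (q : Adj G v u) →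
                  Tiling (Adj (deleteEdge G (u , v , p))) K →
                  Tiling (Adj (deleteEdge G (v , u , q))) K
deleteEdge-flip G p q = transport ↔-refl λ x y → mk⇔
  (λ (x~y , ¬same) → x~y , ¬same ∘ Sum.swap)
  (λ (x~y , ¬same) → x~y , ¬same ∘ Sum.swap)

subdivideEdge-flip : (G : Graph n) {u v : Fin n} (p : Adj G u v) (q : Adj G v u) →
                     Tiling (Adj (subdivideEdge G (u , v , p))) K →
                     Tiling (Adj (subdivideEdge G (v , u , q))) K
subdivideEdge-flip G p q = transport ↔-refl λ
  { zero    zero    → mk⇔ id id
  ; zero    (suc y) → mk⇔ Sum.swap Sum.swap
  ; (suc x) zero    → mk⇔ Sum.swap Sum.swap
  ; (suc x) (suc y) → mk⇔ (λ (x~y , ¬same) → x~y , ¬same ∘ Sum.swap)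
                          (λ (x~y , ¬same) → x~y , ¬same ∘ Sum.swap)
  }

-- Tilings and connectivity of paths.

⌈_/3⌉ : ℕ → ℕ
⌈ 0 /3⌉                 = 0
⌈ 1 /3⌉                 = 1
⌈ 2 /3⌉                 = 1
⌈ suc (suc (suc n)) /3⌉ = suc ⌈ n /3⌉

Consecutive : Rel ℕ 0ℓ
Consecutive i j = suc i ≡ j ⊎ suc j ≡ i

consecutive-+ˡ : ∀ a {i j} → Consecutive i j ⇔ Consecutive (a + i) (a + j)
consecutive-+ˡ a {i} {j} = mk⇔ (Sum.map (up i) (up j)) (Sum.map (down i) (down j))
  where
  up : ∀ i {j} → suc i ≡ j → suc (a + i) ≡ a + j
  up i refl = sym (+-suc a i)

  down : ∀ i {j} → suc (a + i) ≡ a + j → suc i ≡ j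
  down i {j} eq = +-cancelˡ-≡ a (suc i) j (trans (+-suc a i) eq)

-- The centres are 1, 4, 7, …, the last one being replaced by the end of the path
-- if it falls outside; the peaks are 0, 3, 6, … .  Vertex 2 takes the colour of
-- vertex 3 because it lies in the closed neighbourhood of the peak 3.
pathTiling : ∀ n → Tiling (Adj (path n)) (Fin ⌈ n /3⌉)
pathTiling 0 = record
  { centre = λ () ; tile = λ () ; covered = λ () ; peak = λ () ; colour = λ () ; separated = λ () }
pathTiling 1 = record
  { centre    = λ i → i
  ; tile      = λ v → v
  ; covered   = λ _ → refl
  ; peak      = λ i → i
  ; colour    = λ v → v
  ; separated = λ { zero {zero} _ → refl }
  }
pathTiling 2 = record
  { centre    = λ _ → zero
  ; tile      = λ _ → zero
  ; covered   = λ { zero → refl ; (suc zero) → [ inj₂ refl ] }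
  ; peak      = λ _ → zero
  ; colour    = λ _ → zero
  ; separated = λ { zero _ → refl }
  }
pathTiling (suc (suc (suc n))) = record
  { centre    = centre′
  ; tile      = tile′
  ; covered   = covered′
  ; peak      = peak′
  ; colour    = colour′
  ; separated = separated′
  }
  where
  T = pathTiling n

  centre′ : Fin (suc ⌈ n /3⌉) → Fin (3 + n)
  centre′ zero    = suc zero
  centre′ (suc i) = suc (suc (suc (centre T i)))

  tile′ : Fin (3 + n) → Fin (suc ⌈ n /3⌉)
  tile′ zero                = zero
  tile′ (suc zero)          = zero
  tile′ (suc (suc zero))    = zero
  tile′ (suc (suc (suc v))) = suc (tile T v)

  covered′ : ∀ v → ReflClosure (Adj (path (3 + n))) v (centre′ (tile′ v))
  covered′ zero                = [ inj₁ refl ]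
  covered′ (suc zero)          = refl
  covered′ (suc (suc zero))    = [ inj₂ refl ]
  covered′ (suc (suc (suc v))) = Refl.map (Equivalence.to (consecutive-+ˡ 3)) (covered T v)

  peak′ : Fin (suc ⌈ n /3⌉) → Fin (3 + n)
  peak′ zero    = zero
  peak′ (suc i) = suc (suc (suc (peak T i)))

  -- If vertex 2 is the last one, no peak reaches it and `zero` is a default value.
  colour₂ : ∀ {m k} → (Fin m → Fin k) → Fin (suc k)
  colour₂ {zero}  c = zero
  colour₂ {suc m} c = suc (c zero)

  colour₂-zero : ∀ {m k} (c : Fin m → Fin k) (v : Fin m) → toℕ v ≡ 0 → colour₂ c ≡ suc (c v)
  colour₂-zero c zero refl = refl

  colour′ : Fin (3 + n) → Fin (suc ⌈ n /3⌉)
  colour′ zero                = zero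
  colour′ (suc zero)          = zero
  colour′ (suc (suc zero))    = colour₂ (colour T)
  colour′ (suc (suc (suc v))) = suc (colour T v)

  separated′ : ∀ i {v} → ReflClosure (Adj (path (3 + n))) (peak′ i) v → colour′ v ≡ i
  separated′ zero    refl                           = refl
  separated′ zero    {zero} [ _ ]                   = refl
  separated′ zero    {suc zero} [ _ ]               = refl
  separated′ zero    {suc (suc v)} [ inj₁ () ]
  separated′ zero    {suc (suc v)} [ inj₂ () ]
  separated′ (suc i) refl                           = cong suc (separated T i refl)
  separated′ (suc i) {zero} [ inj₁ () ]
  separated′ (suc i) {zero} [ inj₂ () ]
  separated′ (suc i) {suc zero} [ inj₁ () ]
  separated′ (suc i) {suc zero} [ inj₂ () ]
  separated′ (suc i) {suc (suc zero)} [ inj₁ () ]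
  -- A later peak adjacent to vertex 2 can only be vertex 3, whose colour vertex 2 has copied.
  separated′ (suc i) {suc (suc zero)} [ inj₂ 3≡3+p ] =
    trans (colour₂-zero (colour T) (peak T i) (sym (+-cancelˡ-≡ 3 _ _ 3≡3+p)))
          (cong suc (separated T i refl))
  separated′ (suc i) {suc (suc (suc v))} [ p~v ]    =
    cong suc (separated T i [ Equivalence.from (consecutive-+ˡ 3) p~v ])

path-connected : ∀ n → Connected (path n)
path-connected (suc n) u v =
  Star.reverse (λ {x} {y} → adj-sym (path (suc n)) {x} {y}) (fromZero u) ◅◅ fromZero v
  where
  fromZero : ∀ {n} (v : Fin (suc n)) → Star (Adj (path (suc n))) zero v
  fromZero         zero    = ε
  fromZero {suc n} (suc v) =
    inj₁ refl ◅ Star.gmap suc (Equivalence.to (consecutive-+ˡ 1)) (fromZero v)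

-- Deleting an edge of a path.

module Cut {n : ℕ} (u v : Fin n) (1+u≡v : suc (toℕ u) ≡ toℕ v) where

  e : Edge (path n)
  e = u , v , inj₁ 1+u≡v

  Left Right : Fin n → Set
  Left  x = toℕ x < toℕ v
  Right x = toℕ v ≤ toℕ x

  side : ∀ x → Left x ⊎ Right x
  side x with toℕ x <? toℕ v
  ... | yes x<v = inj₁ x<v
  ... | no  x≮v = inj₂ (≮⇒≥ x≮v)

  u-left : Left u
  u-left = ≤-reflexive 1+u≡v

  -- If `y` follows `x`, then `toℕ y` is at most `toℕ v` as `x` is on the left, and at least `toℕ v`
  -- as `y` is on the right. The reverse order contradicts the sides.
  crossing : ∀ {x y} → Left x → Right y → Adj (path n) x y → x ≡ u × y ≡ v
  crossing {x} {y} x<v v≤y (inj₁ 1+x≡y) =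
    toℕ-injective (suc-injective (trans 1+x≡y (trans y≡v (sym 1+u≡v)))) , toℕ-injective y≡v
    where
    y≡v : toℕ y ≡ toℕ v
    y≡v = ≤-antisym (≤-trans (≤-reflexive (sym 1+x≡y)) x<v) v≤y
  crossing {x} {y} x<v v≤y (inj₂ 1+y≡x) =
    contradiction (<-≤-trans (≤-<-trans v≤y (≤-reflexive 1+y≡x)) (<⇒≤ x<v)) (<-irrefl refl)

  deleted⇒¬crossing : ∀ {x y} → Left x → Right y → ¬ Adj (deleteEdge (path n) e) x y
  deleted⇒¬crossing x-left y-right (x~y , ¬same) =
    ¬same (inj₁ (crossing x-left y-right x~y))

  -- The ends of the deleted edge lie on different sides, so edges within one side survive; likewise
  -- for `right-deleted`.
  left-deleted : ∀ {x y} → Left x → Left y → Adj (path n) x y → Adj (deleteEdge (path n) e) x y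
  left-deleted x<v y<v x~y = x~y , λ where
    (inj₁ (_ , refl)) → <-irrefl refl y<v
    (inj₂ (refl , _)) → <-irrefl refl x<v

  right-deleted : ∀ {x y} → Right x → Right y → Adj (path n) x y → Adj (deleteEdge (path n) e) x y
  right-deleted v≤x v≤y x~y = x~y , λ where
    (inj₁ (refl , _)) → <-irrefl refl (<-≤-trans u-left v≤x)
    (inj₂ (_ , refl)) → <-irrefl refl (<-≤-trans u-left v≤y)

-- Along `+↔⊎` the two summands become the two sides of the cut. The separate variable `a` lets `n`
-- be replaced by `a + b`; with `toℕ v` in its place, `n` would occur on both sides of that
-- equation.
deletedPathTiling : ∀ a b → a + b ≡ n →
                    (u v : Fin n) (1+u≡v : suc (toℕ u) ≡ toℕ v) → toℕ v ≡ a →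
                    Tiling (Adj (deleteEdge (path n) (u , v , inj₁ 1+u≡v)))
                           (Fin (⌈ a /3⌉ + ⌈ b /3⌉))
deletedPathTiling a b refl u v 1+u≡v v≡a =
  reindex (↔-sym +↔⊎)
    (transport (↔-sym +↔⊎) iso (disjointUnion (pathTiling a) (pathTiling b)))
  where
  open Cut u v 1+u≡v

  ↑ˡ-left : (x : Fin a) → Left (x ↑ˡ b)
  ↑ˡ-left x = subst₂ _<_ (sym (toℕ-↑ˡ x b)) (sym v≡a) (toℕ<n x)

  ↑ʳ-right : (y : Fin b) → Right (a ↑ʳ y)
  ↑ʳ-right y = subst₂ _≤_ (sym v≡a) (sym (toℕ-↑ʳ a y)) (m≤m+n a (toℕ y))

  iso : ∀ s t → Pointwise (Adj (path a)) (Adj (path b)) s t ⇔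
                Adj (deleteEdge (path (a + b)) e) (join a b s) (join a b t)
  iso (inj₁ x) (inj₁ y) = mk⇔
    (λ { (inj₁ x~y) → left-deleted (↑ˡ-left x) (↑ˡ-left y)
           (subst₂ Consecutive (sym (toℕ-↑ˡ x b)) (sym (toℕ-↑ˡ y b)) x~y) })
    (λ (x~y , _) → inj₁ (subst₂ Consecutive (toℕ-↑ˡ x b) (toℕ-↑ˡ y b) x~y))
  iso (inj₁ x) (inj₂ y) = mk⇔ (λ ())
    (⊥-elim ∘ deleted⇒¬crossing (↑ˡ-left x) (↑ʳ-right y))
  iso (inj₂ x) (inj₁ y) = mk⇔ (λ ())
    (⊥-elim ∘ deleted⇒¬crossing (↑ˡ-left y) (↑ʳ-right x) ∘
     adj-sym (deleteEdge (path (a + b)) e) {a ↑ʳ x} {y ↑ˡ b})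
  iso (inj₂ x) (inj₂ y) = mk⇔
    (λ { (inj₂ x~y) → right-deleted (↑ʳ-right x) (↑ʳ-right y)
           (subst₂ Consecutive (sym (toℕ-↑ʳ a x)) (sym (toℕ-↑ʳ a y))
             (Equivalence.to (consecutive-+ˡ a) x~y)) })
    (λ (x~y , _) → inj₂ (Equivalence.from (consecutive-+ˡ a)
      (subst₂ Consecutive (toℕ-↑ʳ a x) (toℕ-↑ʳ a y) x~y)))

-- Subdividing an edge of a path.

-- Once the right side has moved up by one, vertices on different sides are at least two apart: the
-- new vertex fills the gap.
<⇒¬consecutive-suc : ∀ {i j} → i < j → ¬ Consecutive i (suc j)
<⇒¬consecutive-suc i<j (inj₁ refl) = <-irrefl refl i<j
<⇒¬consecutive-suc i<j (inj₂ refl) = <-irrefl refl (<-≤-trans i<j (m≤n⇒m≤1+n (n≤1+n _)))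

toℕ-punchIn-< : ∀ (i : Fin (suc n)) (j : Fin n) → toℕ j < toℕ i → toℕ (punchIn i j) ≡ toℕ j
toℕ-punchIn-< (suc i) zero    _         = refl
toℕ-punchIn-< (suc i) (suc j) (s≤s j<i) = cong suc (toℕ-punchIn-< i j j<i)

toℕ-punchIn-≥ : ∀ (i : Fin (suc n)) (j : Fin n) → toℕ i ≤ toℕ j → toℕ (punchIn i j) ≡ suc (toℕ j)
toℕ-punchIn-≥ zero    j       _         = refl
toℕ-punchIn-≥ (suc i) (suc j) (s≤s i≤j) = cong suc (toℕ-punchIn-≥ i j i≤j)

-- The new vertex takes the index of v, so that v and everything after it move
-- up by one.
subdividedPathTiling : (u v : Fin n) (1+u≡v : suc (toℕ u) ≡ toℕ v) →
                       Tiling (Adj (subdivideEdge (path n) (u , v , inj₁ 1+u≡v)))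
                              (Fin ⌈ suc n /3⌉)
subdividedPathTiling {n} u v 1+u≡v =
  -- `iso` leads from the subdivided graph to the path, so the tiling of the path travels along its
  -- inverse.
  transport (↔-sym φ) (inverse-iso φ iso) (pathTiling (suc n))
  where
  open Cut u v 1+u≡v

  w : Fin (suc n)
  w = inject₁ v

  -- This sends the new vertex `zero` to `w` and each old vertex `suc x` to `punchIn w x`, which
  -- skips `w`.
  φ : Fin (suc n) ↔ Fin (suc n)
  φ = insert zero w idₚ

  to-left : ∀ {x} → Left x → toℕ (punchIn w x) ≡ toℕ x
  to-left x<v = toℕ-punchIn-< w _ (subst (_ <_) (sym (toℕ-inject₁ v)) x<v)

  to-right : ∀ {x} → Right x → toℕ (punchIn w x) ≡ suc (toℕ x)
  to-right v≤x = toℕ-punchIn-≥ w _ (subst (_≤ _) (sym (toℕ-inject₁ v)) v≤x)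

  new : ∀ y → (y ≡ u ⊎ y ≡ v) ⇔ Consecutive (toℕ w) (toℕ (punchIn w y))
  new y rewrite toℕ-inject₁ v with side y
  ... | inj₁ y<v rewrite to-left y<v = mk⇔
    (λ { (inj₁ refl) → inj₂ 1+u≡v ; (inj₂ refl) → contradiction y<v (<-irrefl refl) })
    (λ { (inj₁ 1+v≡y) → contradiction (<-≤-trans (≤-reflexive 1+v≡y) (<⇒≤ y<v)) (<-irrefl refl)
       ; (inj₂ 1+y≡v) → inj₁ (toℕ-injective (suc-injective (trans 1+y≡v (sym 1+u≡v)))) })
  ... | inj₂ v≤y rewrite to-right v≤y = mk⇔
    (λ { (inj₁ refl) → contradiction (<-≤-trans u-left v≤y) (<-irrefl refl)
       ; (inj₂ refl) → inj₁ refl })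
    (λ { (inj₁ 1+v≡1+y) → inj₂ (toℕ-injective (sym (suc-injective 1+v≡1+y)))
       ; (inj₂ 2+y≡v)   → contradiction
           (≤-trans (n≤1+n _) (≤-trans (≤-reflexive 2+y≡v) v≤y)) (<-irrefl refl) })

  old : ∀ x y → Adj (deleteEdge (path n) e) x y ⇔
                Consecutive (toℕ (punchIn w x)) (toℕ (punchIn w y))
  old x y with side x | side y
  ... | inj₁ x<v | inj₁ y<v rewrite to-left x<v | to-left y<v =
    mk⇔ proj₁ (left-deleted x<v y<v)
  ... | inj₂ v≤x | inj₂ v≤y rewrite to-right v≤x | to-right v≤y = mk⇔
    (Equivalence.to (consecutive-+ˡ 1) ∘ proj₁)
    (right-deleted v≤x v≤y ∘ Equivalence.from (consecutive-+ˡ 1))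
  ... | inj₁ x<v | inj₂ v≤y rewrite to-left x<v | to-right v≤y = mk⇔
    (⊥-elim ∘ deleted⇒¬crossing x<v v≤y)
    (⊥-elim ∘ <⇒¬consecutive-suc (<-≤-trans x<v v≤y))
  ... | inj₂ v≤x | inj₁ y<v rewrite to-right v≤x | to-left y<v = mk⇔
    (⊥-elim ∘ deleted⇒¬crossing y<v v≤x ∘ adj-sym (deleteEdge (path n) e) {x} {y})
    (⊥-elim ∘ <⇒¬consecutive-suc (<-≤-trans y<v v≤x) ∘ Sum.swap)

  iso : ∀ x y → Adj (subdivideEdge (path n) e) x y ⇔
                Adj (path (suc n)) (Inverse.to φ x) (Inverse.to φ y)
  iso zero    zero    = mk⇔ (λ ()) (λ { (inj₁ eq) → 1+n≢n eq ; (inj₂ eq) → 1+n≢n eq })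
  iso zero    (suc y) = new y
  iso (suc x) zero    = mk⇔ (Sum.swap ∘ Equivalence.to (new x)) (Equivalence.from (new x) ∘ Sum.swap)
  iso (suc x) (suc y) = old x y

-- Reduction to an identity between ceilings.

Balanced : ℕ → Set
Balanced n = ∀ a b → suc a + suc b ≡ n → ⌈ suc a /3⌉ + ⌈ suc b /3⌉ ≡ ⌈ suc n /3⌉

sr⇒balanced : IsSRGraph (path n) → Balanced n
sr⇒balanced sr a b refl = begin
  ⌈ suc a /3⌉ + ⌈ suc b /3⌉ ≡⟨ γ-tiling (deletedPathTiling _ _ refl u v 1+u≡v v≡1+a) ⟨
  γ (deleteEdge P e)        ≡⟨ IsSRGraph.removable sr e ⟩
  γ (subdivideEdge P e)     ≡⟨ γ-tiling (subdividedPathTiling u v 1+u≡v) ⟩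
  ⌈ suc (suc a + suc b) /3⌉ ∎
  where
  open ≡-Reasoning

  -- The last of the first `suc a` vertices and the first of the remaining `suc b`.
  u v : Fin (suc a + suc b)
  u = fromℕ a ↑ˡ suc b
  v = suc a ↑ʳ zero

  v≡1+a : toℕ v ≡ suc a
  v≡1+a = trans (toℕ-↑ʳ (suc a) (zero {b})) (+-identityʳ (suc a))

  1+u≡v : suc (toℕ u) ≡ toℕ v
  1+u≡v = trans (cong suc (trans (toℕ-↑ˡ (fromℕ a) (suc b)) (toℕ-fromℕ a))) (sym v≡1+a)

  P = path (suc a + suc b)

  e : Edge P
  e = u , v , inj₁ 1+u≡v

balanced⇒sr : 2 ≤ n → Balanced n → IsSRGraph (path n)
balanced⇒sr {n} 2≤n balanced = record
  { order≥2   = 2≤n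
  ; connected = path-connected n
  ; removable = removable
  }
  where
  -- Here `u` is the lower end of the edge whichever way `e` is oriented, so both orientations share
  -- the count of vertices on each side.
  removableBy : ∀ e → (u v : Fin n) → suc (toℕ u) ≡ toℕ v →
                (∀ b → suc (toℕ u) + suc b ≡ n →
                  Tiling (Adj (deleteEdge (path n) e)) (Fin (⌈ suc (toℕ u) /3⌉ + ⌈ suc b /3⌉))) →
                Tiling (Adj (subdivideEdge (path n) e)) (Fin ⌈ suc n /3⌉) →
                γ (deleteEdge (path n) e) ≡ γ (subdivideEdge (path n) e)
  removableBy e u v 1+u≡v D S with m≤n⇒∃[o]m+o≡n (≤-trans (s≤s (≤-reflexive 1+u≡v)) (toℕ<n v))
  ... | b , 2+u+b≡n =
    trans (γ-tiling (D b a+b≡n)) (trans (balanced (toℕ u) b a+b≡n) (sym (γ-tiling S)))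
    where
    a+b≡n : suc (toℕ u) + suc b ≡ n
    a+b≡n = trans (+-suc (suc (toℕ u)) b) 2+u+b≡n

  removable : ∀ e → γ (deleteEdge (path n) e) ≡ γ (subdivideEdge (path n) e)
  removable e@(u , v , inj₁ 1+u≡v) = removableBy e u v 1+u≡v
    (λ b a+b≡n → deletedPathTiling _ (suc b) a+b≡n u v 1+u≡v (sym 1+u≡v))
    (subdividedPathTiling u v 1+u≡v)
  removable e@(u , v , inj₂ 1+v≡u) = removableBy e v u 1+v≡u
    (λ b a+b≡n → deleteEdge-flip (path n) (inj₁ 1+v≡u) (inj₂ 1+v≡u)
      (deletedPathTiling _ (suc b) a+b≡n v u 1+v≡u (sym 1+v≡u)))
    (subdivideEdge-flip (path n) (inj₁ 1+v≡u) (inj₂ 1+v≡u) (subdividedPathTiling v u 1+v≡u))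

-- Arithmetic modulo 3.

-- The ceiling increases from `m` to `suc m` only when 3 divides `m`; removing threes leaves the
-- cases 0, 1 and 2.
⌈/3⌉-step⇒%3 : ∀ m → ⌈ suc m /3⌉ ≡ suc ⌈ m /3⌉ → suc m % 3 ≡ 1
⌈/3⌉-step⇒%3 0 _ = refl
⌈/3⌉-step⇒%3 1 ()
⌈/3⌉-step⇒%3 2 ()
⌈/3⌉-step⇒%3 (suc (suc (suc m))) eq = ⌈/3⌉-step⇒%3 m (suc-injective eq)

-- Cutting off one vertex and cutting off three vertices determine n modulo 3.
balanced⇒%3 : 2 ≤ n → Balanced n → n ≡ 3 ⊎ (4 ≤ n × n % 3 ≡ 1)
balanced⇒%3 {1} (s≤s ()) _
balanced⇒%3 {2} _ balanced with () ← balanced 0 0 refl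
balanced⇒%3 {3} _ _ = inj₁ refl
balanced⇒%3 {suc (suc (suc (suc m)))} _ balanced =
  -- Cutting off three vertices gives `⌈ 1 + m /3⌉ ≡ ⌈ 2 + m /3⌉`, and cutting off one gives
  -- `suc ⌈ m /3⌉ ≡ ⌈ 2 + m /3⌉`. So the ceiling increases at `m`, and `4 + m` has the same residue
  -- as `1 + m`.
  inj₂ (s≤s (s≤s (s≤s (s≤s z≤n))) , ⌈/3⌉-step⇒%3 m
    (trans (suc-injective (balanced 2 m refl)) (sym (suc-injective (balanced 0 (2 + m) refl)))))

-- Lowering `a` or `b` by 3 lowers both sides by one. Among residues below 3 the hypothesis leaves
-- only the pairs with sum 2.
%3⇒⌈/3⌉-+ : ∀ a b → suc (suc (a + b)) % 3 ≡ 1 →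
            ⌈ suc a /3⌉ + ⌈ suc b /3⌉ ≡ suc ⌈ a + b /3⌉
%3⇒⌈/3⌉-+ (suc (suc (suc a))) b h = cong suc (%3⇒⌈/3⌉-+ a b h)
%3⇒⌈/3⌉-+ 0 (suc (suc (suc b))) h = cong suc (%3⇒⌈/3⌉-+ 0 b h)
%3⇒⌈/3⌉-+ 1 (suc (suc (suc b))) h = cong suc (%3⇒⌈/3⌉-+ 1 b h)
%3⇒⌈/3⌉-+ 2 (suc (suc (suc b))) h = cong suc (%3⇒⌈/3⌉-+ 2 b h)
%3⇒⌈/3⌉-+ 0 2 _ = refl
%3⇒⌈/3⌉-+ 1 1 _ = refl
%3⇒⌈/3⌉-+ 2 0 _ = refl

-- A larger multiple of 3 fails when three vertices are cut off. The path of order 3 has no such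
-- cut: its parts have sizes 1 and 2.
%3⇒balanced : n ≡ 3 ⊎ (4 ≤ n × n % 3 ≡ 1) → Balanced n
%3⇒balanced (inj₁ refl) (suc (suc (suc _))) _ ()
%3⇒balanced (inj₁ refl)    0 1 _    = refl
%3⇒balanced (inj₁ refl)    1 0 _    = refl
%3⇒balanced (inj₂ (_ , h)) a b refl rewrite +-suc a b = %3⇒⌈/3⌉-+ a b h

proposition2 : (n : ℕ) → 2 ≤ n → IsSRGraph (path n) ⇔ (n ≡ 3 ⊎ (4 ≤ n × n % 3 ≡ 1))
proposition2 n 2≤n = mk⇔ (balanced⇒%3 2≤n ∘ sr⇒balanced) (balanced⇒sr 2≤n ∘ %3⇒balanced)
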